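{- Let $\mathcal{F}$ be the folded component and $\mathcal{T}$ a stacked component (the vertex-disjoint graphs specified in the context). If the new edge $\mathcal{E}=\{v_1,v_2\}$ joins a floor vertex $v_1\in V(\mathcal{F})$ to a floor vertex $v_2\in V(\mathcal{T})$, then $$\tfrac34(\mathrm{ord}(\ell)+5)\ \le\ \mathrm{diam}(\mathcal{F}+\mathcal{E}+\mathcal{T})\ \le\ \mathrm{ord}(\ell)+3,$$ where $\mathcal{F}+\mathcal{E}+\mathcal{T}$ is the disjoint union of $\mathcal{F}$ and $\mathcal{T}$ together with the edge $\mathcal{E}$.
   Context: Let $p$ be a prime with $p\equiv 71$ or $119\pmod{120}$, let $\ell=2$, and let $L=\mathrm{ord}(\ell)$ be the order, in the ideal class group of $\mathbb{Q}(\sqrt{ -p})$, of a prime ideal above $2$; it is an odd integer $\ge 3$. The folded and stacked components are the components of the supersingular $2$-isogeny graph over $\mathbb{F}_p$ after identifying curves up to $\overline{\mathbb{F}_p}$-isomorphism, regarded as simple undirected graphs. The folded component $\mathcal{F}$ is labelled so that $V(\mathcal{F})=\{0,1,\dots,L-1\}$ and $$E(\mathcal{F})=\{\{2k-1,2k+1\}: 1\le k\le \tfrac12(L-3)\}\cup\{\{2k+1,2k+2\}:0\le k\le \tfrac12(L-3)\}\cup\{\{0,1\}\};$$ its floor vertices are the nonzero even vertices. A stacked component $\mathcal{T}$ is labelled so that $V(\mathcal{T})=\{0,1,\dots,2L-1\}$ and $$E(\mathcal{T})=\{\{2i,2i+1\}:0\le i\le L-1\}\cup\{\{2i+1,2i+3\}:0\le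 i\le L-2\}\cup\{\{2L-1,1\}\};$$ its floor vertices are the even vertices. (The vertex sets are regarded as disjoint.) The new edge $\mathcal{E}$ is the single edge coming from $2$-isogenies not defined over $\mathbb{F}_p$ that must be added to obtain the spine; its endpoints are always two distinct floor vertices. The diameter is the maximum graph distance between two vertices. -}

module Defs where

open import Algebra.Bundles using (CommutativeRing)
open import Data.Fin.Base using (Fin; toℕ)
open import Data.Integer.Base as ℤ using (ℤ; +_; 0ℤ; 1ℤ)
open import Data.Integer.Properties as ℤP using ()
open import Data.Integer.Tactic.RingSolver using (solve-∀)
open import Data.Nat.Base using (ℕ; zero; suc; _+_; _*_; _∸_; _/_; _≤_)
open import Data.Nat.Divisibility using (_∣_)
open import Data.Product.Base using (_×_; _,_; ∃-syntax; ∃₂)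
open import Data.Sum.Base using (_⊎_; inj₁; inj₂)
open import Level using (0ℓ)
open import Relation.Binary.Construct.Closure.Symmetric as Sym using (SymClosure)
open import Relation.Binary.Core using (Rel)
open import Relation.Binary.Definitions using (Symmetric)
open import Relation.Binary.PropositionalEquality
  using (_≡_; _≢_; refl; cong; cong₂; isEquivalence; ≢-sym)
open import Relation.Nullary using (¬_)
open import Relation.Unary using (Pred; _≐_)

------------------------------------------------------------------------
-- Ideals and ideal classes

module Ideals (R : CommutativeRing 0ℓ 0ℓ) where

  open CommutativeRing R using (Carrier; _≈_; _≉_; 0#; 1#; *-assoc; distribˡ; zeroʳ)
    renaming (_+_ to _+ᴿ_; _*_ to _*ᴿ_; refl to ≈-refl; sym to ≈-sym;
              *-congˡ to *ᴿ-congˡ)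

  record Ideal : Set₁ where
    field
      members  : Pred Carrier 0ℓ
      resp     : ∀ {x y} → x ≈ y → members x → members y
      0∈       : members 0#
      +-closed : ∀ {x y} → members x → members y → members (x +ᴿ y)
      *-absorb : ∀ r {x} → members x → members (r *ᴿ x)

  open Ideal using (members)

  infix 4 _∈ᴵ_ _≈ᴵ_ _∼_
  infixl 7 _·_
  infixr 8 _^ᴵ_

  _∈ᴵ_ : Carrier → Ideal → Set
  x ∈ᴵ I = members I x

  _≈ᴵ_ : Ideal → Ideal → Set
  I ≈ᴵ J = members I ≐ members J

  -- The additive subgroup spanned by S; it needs no clause for negatives
  -- when S is stable under multiplication by ring elements.
  data Span (S : Pred Carrier 0ℓ) : Pred Carrier 0ℓ where
    gen  : ∀ {x} → S x → Span S x
    zero : Span S 0#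
    add  : ∀ {x y} → Span S x → Span S y → Span S (x +ᴿ y)
    resp : ∀ {x y} → x ≈ y → Span S x → Span S y

  spanIdeal : (S : Pred Carrier 0ℓ) → (∀ r {x} → S x → Span S (r *ᴿ x)) → Ideal
  spanIdeal S stable = record
    { members  = Span S
    ; resp     = resp
    ; 0∈       = zero
    ; +-closed = add
    ; *-absorb = absorb
    }
    where
    absorb : ∀ r {x} → Span S x → Span S (r *ᴿ x)
    absorb r (gen s)    = stable r s
    absorb r zero       = resp (≈-sym (zeroʳ r)) zero
    absorb r (add s t)  = resp (≈-sym (distribˡ r _ _)) (add (absorb r s) (absorb r t))
    absorb r (resp e s) = resp (*ᴿ-congˡ e) (absorb r s)

  principal : Carrier → Ideal
  principal a = spanIdeal (λ x → ∃[ r ] x ≈ r *ᴿ a) λ where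
    r (s , e) → resp (*ᴿ-congˡ (≈-sym e)) (gen (r *ᴿ s , ≈-sym (*-assoc r s a)))

  _·_ : Ideal → Ideal → Ideal
  I · J = spanIdeal (λ z → ∃₂ λ x y → x ∈ᴵ I × y ∈ᴵ J × z ≈ x *ᴿ y) λ where
    r (x , y , x∈I , y∈J , e) →
      resp (*ᴿ-congˡ (≈-sym e))
        (gen (r *ᴿ x , y , Ideal.*-absorb I r x∈I , y∈J , ≈-sym (*-assoc r x y)))

  unitIdeal : Ideal
  unitIdeal = principal 1#

  _^ᴵ_ : Ideal → ℕ → Ideal
  I ^ᴵ zero  = unitIdeal
  I ^ᴵ suc n = I · (I ^ᴵ n)

  IsPrimeIdeal : Ideal → Set
  IsPrimeIdeal P =
    ¬ (1# ∈ᴵ P) × (∀ x y → (x *ᴿ y) ∈ᴵ P → x ∈ᴵ P ⊎ y ∈ᴵ P)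

  -- Equality in the ideal class group of a Dedekind domain: αI = βJ for
  -- some nonzero α and β.
  _∼_ : Ideal → Ideal → Set
  I ∼ J = ∃₂ λ α β → α ≉ 0# × β ≉ 0# × principal α · I ≈ᴵ principal β · J

  IsClassOrder : Ideal → ℕ → Set
  IsClassOrder I n =
    1 ≤ n × (I ^ᴵ n) ∼ unitIdeal × (∀ m → 1 ≤ m → (I ^ᴵ m) ∼ unitIdeal → n ≤ m)

------------------------------------------------------------------------
-- The maximal order of an imaginary quadratic field

-- For p ≡ 3 (mod 4) squarefree, the ring of integers of ℚ(√-p) is ℤ[ω] with
-- ω = (1 + √-p)/2, so that ω² = ω - c where c = (p + 1)/4.  The pair (a , b)
-- stands for a + bω.
module MaximalOrder (p : ℕ) where

  c : ℤ
  c = + ((p + 1) / 4)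

  𝓞 : Set
  𝓞 = ℤ × ℤ

  infixl 6 _⊕_
  infixl 7 _⊗_

  _⊕_ _⊗_ : 𝓞 → 𝓞 → 𝓞
  (a , b) ⊕ (a′ , b′) = (a ℤ.+ a′ , b ℤ.+ b′)
  (a , b) ⊗ (a′ , b′) =
    (a ℤ.* a′ ℤ.- c ℤ.* (b ℤ.* b′) , a ℤ.* b′ ℤ.+ b ℤ.* a′ ℤ.+ b ℤ.* b′)

  ⊖_ : 𝓞 → 𝓞
  ⊖ (a , b) = (ℤ.- a , ℤ.- b)

  private
    assoc₁ : ∀ c a b a′ b′ a″ b″ →
      (a ℤ.* a′ ℤ.- c ℤ.* (b ℤ.* b′)) ℤ.* a″
        ℤ.- c ℤ.* ((a ℤ.* b′ ℤ.+ b ℤ.* a′ ℤ.+ b ℤ.* b′) ℤ.* b″)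
      ≡ a ℤ.* (a′ ℤ.* a″ ℤ.- c ℤ.* (b′ ℤ.* b″))
        ℤ.- c ℤ.* (b ℤ.* (a′ ℤ.* b″ ℤ.+ b′ ℤ.* a″ ℤ.+ b′ ℤ.* b″))
    assoc₁ = solve-∀

    assoc₂ : ∀ c a b a′ b′ a″ b″ →
      (a ℤ.* a′ ℤ.- c ℤ.* (b ℤ.* b′)) ℤ.* b″
        ℤ.+ (a ℤ.* b′ ℤ.+ b ℤ.* a′ ℤ.+ b ℤ.* b′) ℤ.* a″
        ℤ.+ (a ℤ.* b′ ℤ.+ b ℤ.* a′ ℤ.+ b ℤ.* b′) ℤ.* b″
      ≡ a ℤ.* (a′ ℤ.* b″ ℤ.+ b′ ℤ.* a″ ℤ.+ b′ ℤ.* b″)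
        ℤ.+ b ℤ.* (a′ ℤ.* a″ ℤ.- c ℤ.* (b′ ℤ.* b″))
        ℤ.+ b ℤ.* (a′ ℤ.* b″ ℤ.+ b′ ℤ.* a″ ℤ.+ b′ ℤ.* b″)
    assoc₂ = solve-∀

    comm₁ : ∀ c a b a′ b′ →
      a ℤ.* a′ ℤ.- c ℤ.* (b ℤ.* b′) ≡ a′ ℤ.* a ℤ.- c ℤ.* (b′ ℤ.* b)
    comm₁ = solve-∀

    comm₂ : ∀ a b a′ b′ →
      a ℤ.* b′ ℤ.+ b ℤ.* a′ ℤ.+ b ℤ.* b′ ≡ a′ ℤ.* b ℤ.+ b′ ℤ.* a ℤ.+ b′ ℤ.* b
    comm₂ = solve-∀

    idˡ₁ : ∀ c a b → 1ℤ ℤ.* a ℤ.- c ℤ.* (0ℤ ℤ.* b) ≡ a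
    idˡ₁ = solve-∀

    idˡ₂ : ∀ a b → 1ℤ ℤ.* b ℤ.+ 0ℤ ℤ.* a ℤ.+ 0ℤ ℤ.* b ≡ b
    idˡ₂ = solve-∀

    idʳ₁ : ∀ c a b → a ℤ.* 1ℤ ℤ.- c ℤ.* (b ℤ.* 0ℤ) ≡ a
    idʳ₁ = solve-∀

    idʳ₂ : ∀ a b → a ℤ.* 0ℤ ℤ.+ b ℤ.* 1ℤ ℤ.+ b ℤ.* 0ℤ ≡ b
    idʳ₂ = solve-∀

    distˡ₁ : ∀ c a b a′ b′ a″ b″ →
      a ℤ.* (a′ ℤ.+ a″) ℤ.- c ℤ.* (b ℤ.* (b′ ℤ.+ b″))
      ≡ a ℤ.* a′ ℤ.- c ℤ.* (b ℤ.* b′) ℤ.+ (a ℤ.* a″ ℤ.- c ℤ.* (b ℤ.* b″))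
    distˡ₁ = solve-∀

    distˡ₂ : ∀ a b a′ b′ a″ b″ →
      a ℤ.* (b′ ℤ.+ b″) ℤ.+ b ℤ.* (a′ ℤ.+ a″) ℤ.+ b ℤ.* (b′ ℤ.+ b″)
      ≡ a ℤ.* b′ ℤ.+ b ℤ.* a′ ℤ.+ b ℤ.* b′ ℤ.+ (a ℤ.* b″ ℤ.+ b ℤ.* a″ ℤ.+ b ℤ.* b″)
    distˡ₂ = solve-∀

    distʳ₁ : ∀ c a b a′ b′ a″ b″ →
      (a′ ℤ.+ a″) ℤ.* a ℤ.- c ℤ.* ((b′ ℤ.+ b″) ℤ.* b)
      ≡ a′ ℤ.* a ℤ.- c ℤ.* (b′ ℤ.* b) ℤ.+ (a″ ℤ.* a ℤ.- c ℤ.* (b″ ℤ.* b))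
    distʳ₁ = solve-∀

    distʳ₂ : ∀ a b a′ b′ a″ b″ →
      (a′ ℤ.+ a″) ℤ.* b ℤ.+ (b′ ℤ.+ b″) ℤ.* a ℤ.+ (b′ ℤ.+ b″) ℤ.* b
      ≡ a′ ℤ.* b ℤ.+ b′ ℤ.* a ℤ.+ b′ ℤ.* b ℤ.+ (a″ ℤ.* b ℤ.+ b″ ℤ.* a ℤ.+ b″ ℤ.* b)
    distʳ₂ = solve-∀

  ring : CommutativeRing 0ℓ 0ℓ
  ring = record
    { Carrier = 𝓞
    ; _≈_ = _≡_
    ; _+_ = _⊕_
    ; _*_ = _⊗_
    ; -_ = ⊖_
    ; 0# = (0ℤ , 0ℤ)
    ; 1# = (1ℤ , 0ℤ)
    ; isCommutativeRing = record
      { isRing = record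
        { +-isAbelianGroup = record
          { isGroup = record
            { isMonoid = record
              { isSemigroup = record
                { isMagma = record
                  { isEquivalence = isEquivalence
                  ; ∙-cong = cong₂ _⊕_
                  }
                ; assoc = λ (a , b) (a′ , b′) (a″ , b″) →
                    cong₂ _,_ (ℤP.+-assoc a a′ a″) (ℤP.+-assoc b b′ b″)
                }
              ; identity =
                  (λ (a , b) → cong₂ _,_ (ℤP.+-identityˡ a) (ℤP.+-identityˡ b))
                , (λ (a , b) → cong₂ _,_ (ℤP.+-identityʳ a) (ℤP.+-identityʳ b))
              }
            ; inverse =
                (λ (a , b) → cong₂ _,_ (ℤP.+-inverseˡ a) (ℤP.+-inverseˡ b))
              , (λ (a , b) → cong₂ _,_ (ℤP.+-inverseʳ a) (ℤP.+-inverseʳ b))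
            ; ⁻¹-cong = cong ⊖_
            }
          ; comm = λ (a , b) (a′ , b′) →
              cong₂ _,_ (ℤP.+-comm a a′) (ℤP.+-comm b b′)
          }
        ; *-cong = cong₂ _⊗_
        ; *-assoc = λ (a , b) (a′ , b′) (a″ , b″) →
            cong₂ _,_ (assoc₁ c a b a′ b′ a″ b″) (assoc₂ c a b a′ b′ a″ b″)
        ; *-identity =
            (λ (a , b) → cong₂ _,_ (idˡ₁ c a b) (idˡ₂ a b))
          , (λ (a , b) → cong₂ _,_ (idʳ₁ c a b) (idʳ₂ a b))
        ; distrib =
            (λ (a , b) (a′ , b′) (a″ , b″) →
              cong₂ _,_ (distˡ₁ c a b a′ b′ a″ b″) (distˡ₂ a b a′ b′ a″ b″))
          , (λ (a , b) (a′ , b′) (a″ , b″) →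
              cong₂ _,_ (distʳ₁ c a b a′ b′ a″ b″) (distʳ₂ a b a′ b′ a″ b″))
        }
      ; *-comm = λ (a , b) (a′ , b′) →
          cong₂ _,_ (comm₁ c a b a′ b′) (comm₂ a b a′ b′)
      }
    }

  open Ideals ring public

  two : 𝓞
  two = (+ 2 , 0ℤ)

-- L is the order, in the class group of ℚ(√-p), of a prime ideal above 2.
IsOrd₂ : (p L : ℕ) → Set₁
IsOrd₂ p L = ∃[ 𝔭 ] IsPrimeIdeal 𝔭 × two ∈ᴵ 𝔭 × IsClassOrder 𝔭 L
  where open MaximalOrder p

------------------------------------------------------------------------
-- Simple graphs, distance and diameter

record SimpleGraph : Set₁ where
  field
    Vertex      : Set
    Adj         : Rel Vertex 0ℓ
    symmetric   : Symmetric Adj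
    irreflexive : ∀ {v} → ¬ Adj v v

open SimpleGraph public using (Vertex)
open SimpleGraph

data Walk (G : SimpleGraph) : ℕ → Rel (Vertex G) 0ℓ where
  []  : ∀ {u} → Walk G 0 u u
  _∷_ : ∀ {u v w n} → Adj G u v → Walk G n v w → Walk G (suc n) u w

IsDistance : (G : SimpleGraph) → Vertex G → Vertex G → ℕ → Set
IsDistance G u v d = Walk G d u v × (∀ n → Walk G n u v → d ≤ n)

IsDiameter : SimpleGraph → ℕ → Set
IsDiameter G d =
    (∀ u v → ∃[ k ] IsDistance G u v k × k ≤ d)
  × (∃₂ λ u v → IsDistance G u v d)

-- The simple graph on {0, …, n - 1} whose edges are the sets {i, j} with
-- E i j; degenerate sets {i, i} are discarded.
fromEdges : (n : ℕ) → Rel ℕ 0ℓ → SimpleGraph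
fromEdges n E = record
  { Vertex      = Fin n
  ; Adj         = λ u v → u ≢ v × SymClosure E (toℕ u) (toℕ v)
  ; symmetric   = λ (u≢v , e) → ≢-sym u≢v , Sym.symmetric E e
  ; irreflexive = λ (v≢v , _) → v≢v refl
  }

-- The disjoint union of G and H together with the edge {v₁, v₂}.
data JoinAdj (G H : SimpleGraph) (v₁ : Vertex G) (v₂ : Vertex H) :
             Rel (Vertex G ⊎ Vertex H) 0ℓ where
  left   : ∀ {u v} → Adj G u v → JoinAdj G H v₁ v₂ (inj₁ u) (inj₁ v)
  right  : ∀ {u v} → Adj H u v → JoinAdj G H v₁ v₂ (inj₂ u) (inj₂ v)
  edge₁₂ : JoinAdj G H v₁ v₂ (inj₁ v₁) (inj₂ v₂)
  edge₂₁ : JoinAdj G H v₁ v₂ (inj₂ v₂) (inj₁ v₁)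

join : (G H : SimpleGraph) → Vertex G → Vertex H → SimpleGraph
join G H v₁ v₂ = record
  { Vertex      = Vertex G ⊎ Vertex H
  ; Adj         = JoinAdj G H v₁ v₂
  ; symmetric   = λ where
      (left e)  → left (symmetric G e)
      (right e) → right (symmetric H e)
      edge₁₂    → edge₂₁
      edge₂₁    → edge₁₂
  ; irreflexive = λ where
      (left e)  → irreflexive G e
      (right e) → irreflexive H e
  }

------------------------------------------------------------------------
-- Folded and stacked components, for L odd with 3 ≤ L

data FoldedEdge (L i j : ℕ) : Set where
  odd–odd   : ∀ k → 1 ≤ k → k ≤ (L ∸ 3) / 2 →
              i ≡ 2 * k ∸ 1 → j ≡ 2 * k + 1 → FoldedEdge L i j
  odd–floor : ∀ k → k ≤ (L ∸ 3) / 2 →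
              i ≡ 2 * k + 1 → j ≡ 2 * k + 2 → FoldedEdge L i j
  zero–one  : i ≡ 0 → j ≡ 1 → FoldedEdge L i j

folded : ℕ → SimpleGraph
folded L = fromEdges L (FoldedEdge L)

IsFoldedFloor : ∀ {L} → Vertex (folded L) → Set
IsFoldedFloor v = 2 ∣ toℕ v × toℕ v ≢ 0

data StackedEdge (L i j : ℕ) : Set where
  floor–odd : ∀ k → k ≤ L ∸ 1 →
              i ≡ 2 * k → j ≡ 2 * k + 1 → StackedEdge L i j
  odd–odd   : ∀ k → k ≤ L ∸ 2 →
              i ≡ 2 * k + 1 → j ≡ 2 * k + 3 → StackedEdge L i j
  closing   : i ≡ 2 * L ∸ 1 → j ≡ 1 → StackedEdge L i j

stacked : ℕ → SimpleGraph
stacked L = fromEdges (2 * L) (StackedEdge L)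

IsStackedFloor : ∀ {L} → Vertex (stacked L) → Set
IsStackedFloor v = 2 ∣ toℕ v

{-# OPTIONS --safe #-}
module Submission where

-- Write L = 3 + 2m.  The folded component is a path with m + 1 vertices carrying
-- leaves, the stacked one a cycle with L vertices carrying leaves, and v₁ and v₂
-- are leaves.  If v₁ hangs at the k-th vertex of the path, its eccentricity in the
-- folded component is 2 + max(k, m - k), that of v₂ in the stacked component is
-- 3 + m, and the two components have diameters at most 2 + m and 3 + m.  Hence the
-- diameter of the join is max(k, m - k) + m + 6, and m ≤ 2 max(k, m - k) ≤ 2m gives
-- both bounds.  Eccentricities are bounded from below by 1-Lipschitz functions
-- vanishing at v₁ and v₂.

open import Defs
open import Data.Fin.Base using (Fin; toℕ; fromℕ<) renaming (zero to 0F)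
import Data.Fin.Properties as Fin
open import Data.Integer.Base as ℤ using (+_)
import Data.Integer.Properties as ℤ
open import Data.Nat.Base as ℕ
  using (ℕ; zero; suc; _+_; _*_; _∸_; _⊓_; _⊔_; ∣_-_∣; ⌊_/2⌋; pred;
         _≤_; _<_; _%_; z≤n; s≤s; s≤s⁻¹)
open import Data.Nat.Divisibility using (_∣_; divides)
open import Data.Nat.DivMod using (m*n/n≡m)
open import Data.Nat.Primality using (Prime)
open import Data.Nat.Properties
open import Data.Nat.Tactic.RingSolver using (solve-∀)
open import Data.Product.Base using (_×_; _,_; ∃-syntax; proj₁; proj₂)
open import Data.Rational.Unnormalised.Base as ℚ using (_/_)
open import Data.Sum.Base using (_⊎_; inj₁; inj₂)
import Data.Sum.Properties as Sum
open import Function.Base using (_∘_)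
open import Level using (0ℓ)
open import Relation.Binary.Construct.Closure.Symmetric using (SymClosure; fwd; bwd)
open import Relation.Binary.Core using (Rel; _⇒_)
import Relation.Binary.Definitions as B
open import Relation.Binary.PropositionalEquality
  using (_≡_; _≢_; refl; sym; trans; cong; cong₂; subst; subst₂; module ≡-Reasoning)
open import Relation.Nullary using (¬_; Dec; yes; no; contradiction)
open import Relation.Nullary.Decidable using (map′; _×-dec_; _⊎-dec_; ¬?)
open import Relation.Unary using (Pred; Decidable)

open SimpleGraph using (Adj; symmetric)

-- Distances, diameters and joins

-- A walk of positive length is decided by trying every second vertex. The vertices of a join form a
-- sum of two finite types, so exhaustive search is kept abstract and carried over to sums.
Searchable : Set → Set₁
Searchable A = {P : Pred A 0ℓ} → Decidable P → Dec (∃[ x ] P x)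

⊎-searchable : ∀ {A B} → Searchable A → Searchable B → Searchable (A ⊎ B)
⊎-searchable search-A search-B P? =
  map′ (λ { (inj₁ (a , p)) → inj₁ a , p ; (inj₂ (b , p)) → inj₂ b , p })
       (λ { (inj₁ a , p) → inj₁ (a , p) ; (inj₂ b , p) → inj₂ (b , p) })
       (search-A (P? ∘ inj₁) ⊎-dec search-B (P? ∘ inj₂))

least : ∀ {P : Pred ℕ 0ℓ} → Decidable P → ∀ n → P n →
        ∃[ k ] k ≤ n × P k × (∀ j → P j → k ≤ j)
least P? zero    p = 0 , z≤n , p , λ _ _ → z≤n
least P? (suc n) p with P? 0
... | yes p₀ = 0 , z≤n , p₀ , λ _ _ → z≤n
... | no ¬p₀ with least (P? ∘ suc) n p
...   | k , k≤n , q , k-least = suc k , s≤s k≤n , q , λ where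
          zero    p₀ → contradiction p₀ ¬p₀
          (suc j) pⱼ → s≤s (k-least j pⱼ)

Within : (G : SimpleGraph) → ℕ → Rel (Vertex G) 0ℓ
Within G d u v = ∃[ k ] k ≤ d × Walk G k u v

module _ {G : SimpleGraph} where

  _++_ : ∀ {m n u v w} → Walk G m u v → Walk G n v w → Walk G (m + n) u w
  []      ++ q = q
  (e ∷ p) ++ q = e ∷ (p ++ q)

  within-refl : ∀ {d u} → Within G d u u
  within-refl = 0 , z≤n , []

  within-adj : ∀ {u v} → Adj G u v → Within G 1 u v
  within-adj e = 1 , ≤-refl , e ∷ []

  within-trans : ∀ {d e u v w} → Within G d u v → Within G e v w → Within G (d + e) u w
  within-trans (k , k≤d , p) (l , l≤e , q) = k + l , +-mono-≤ k≤d l≤e , p ++ q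

  within-mono : ∀ {d e u v} → d ≤ e → Within G d u v → Within G e u v
  within-mono d≤e (k , k≤d , p) = k , ≤-trans k≤d d≤e , p

  reverse : ∀ {n u v} → Walk G n u v → Walk G n v u
  reverse []                  = []
  reverse {u = u} {v = w} (_∷_ {n = n} e p) =
    subst (λ l → Walk G l w u) (+-comm n 1) (reverse p ++ (symmetric G e ∷ []))

  within-sym : ∀ {d u v} → Within G d u v → Within G d v u
  within-sym (k , k≤d , p) = k , k≤d , reverse p

  walk? : B.DecidableEquality (Vertex G) → Searchable (Vertex G) → B.Decidable (Adj G) →
          ∀ n u v → Dec (Walk G n u v)
  walk? _≟ⱽ_ search adj? zero u v = map′ (λ { refl → [] }) (λ { [] → refl }) (u ≟ⱽ v)
  walk? _≟ⱽ_ search adj? (suc n) u w =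
    map′ (λ { (_ , e , p) → e ∷ p }) (λ { (e ∷ p) → _ , e , p })
         (search (λ v → adj? u v ×-dec walk? _≟ⱽ_ search adj? n v w))

  -- Exact distances come from minimising over the decidable walk lengths up to the bound given by
  -- `near`. At `x` and `y` the upper and lower bounds meet, so this pair attains `d`.
  isDiameter : B.DecidableEquality (Vertex G) → Searchable (Vertex G) → B.Decidable (Adj G) →
               ∀ {d} → (∀ u v → Within G d u v) →
               ∀ x y → (∀ n → Walk G n x y → d ≤ n) → IsDiameter G d
  isDiameter _≟ⱽ_ search adj? {d} near x y far = distances , x , y , attained (near x y)
    where
    distances : ∀ u v → ∃[ k ] IsDistance G u v k × k ≤ d
    distances u v with near u v
    ... | n , n≤d , p with least (λ l → walk? _≟ⱽ_ search adj? l u v) n p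
    ...   | k , k≤n , q , k-least = k , (q , k-least) , ≤-trans k≤n n≤d

    attained : Within G d x y → IsDistance G x y d
    attained (k , k≤d , p) = subst (λ l → Walk G l x y) (≤-antisym k≤d (far k p)) p , far

-- One inequality suffices because adjacency is symmetric. If `f` vanishes at a vertex, then `f u`
-- is a lower bound for the distance from `u` to it.
Lipschitz : (G : SimpleGraph) → (Vertex G → ℕ) → Set
Lipschitz G f = ∀ {u v} → Adj G u v → f u ≤ suc (f v)

module _ {G H : SimpleGraph} {v₁ : Vertex G} {v₂ : Vertex H} where

  private J = join G H v₁ v₂

  within-left : ∀ {d u v} → Within G d u v → Within J d (inj₁ u) (inj₁ v)
  within-left (k , k≤d , p) = k , k≤d , go p
    where
    go : ∀ {n u v} → Walk G n u v → Walk J n (inj₁ u) (inj₁ v)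
    go []      = []
    go (e ∷ p) = left e ∷ go p

  within-right : ∀ {d u v} → Within H d u v → Within J d (inj₂ u) (inj₂ v)
  within-right (k , k≤d , p) = k , k≤d , go p
    where
    go : ∀ {n u v} → Walk H n u v → Walk J n (inj₂ u) (inj₂ v)
    go []      = []
    go (e ∷ p) = right e ∷ go p

  join-within : ∀ {a b c} → (∀ u → Within G a u v₁) → (∀ v → Within H b v v₂) →
                (∀ u u′ → Within G c u u′) → (∀ v v′ → Within H c v v′) →
                c ≤ a + suc b → ∀ x y → Within J (a + suc b) x y
  join-within {a} {b} to-v₁ to-v₂ diam-G diam-H c≤ = λ where
      (inj₁ u) (inj₁ u′) → within-mono c≤ (within-left (diam-G u u′))
      (inj₂ v) (inj₂ v′) → within-mono c≤ (within-right (diam-H v v′))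
      (inj₁ u) (inj₂ v)  → across u v
      (inj₂ v) (inj₁ u)  → within-sym (across u v)
    where
    across : ∀ u v → Within J (a + suc b) (inj₁ u) (inj₂ v)
    across u v = within-trans (within-left (to-v₁ u))
      (within-trans (within-adj edge₁₂) (within-right (within-sym (to-v₂ v))))

  -- Before first crossing the bridge a walk needs `g u` steps, then one for the bridge, then at
  -- least `h w`. It may cross back again, so `from-right` is proved by mutual induction for walks
  -- from any `v`, with `h v` as slack.
  join-far : ∀ {g h} → Lipschitz G g → g v₁ ≡ 0 → Lipschitz H h → h v₂ ≡ 0 →
             ∀ u w n → Walk J n (inj₁ u) (inj₂ w) → g u + suc (h w) ≤ n
  join-far {g} {h} g-lip g-v₁ h-lip h-v₂ u w n = from-left
    where
    from-left  : ∀ {n u} → Walk J n (inj₁ u) (inj₂ w) → g u + suc (h w) ≤ n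
    from-right : ∀ {n v} → Walk J n (inj₂ v) (inj₂ w) → h w ≤ n + h v

    from-left (left e ∷ p) =
      ≤-trans (+-monoˡ-≤ (suc (h w)) (g-lip e)) (s≤s (from-left p))
    from-left {n = suc n} (edge₁₂ ∷ p) rewrite g-v₁ =
      s≤s (subst (h w ≤_) (trans (cong (λ k → n + k) h-v₂) (+-identityʳ n)) (from-right p))

    from-right [] = ≤-refl
    from-right {suc n} {v} (_∷_ {v = inj₂ v′} (right e) p) = begin
      h w             ≤⟨ from-right p ⟩
      n + h v′        ≤⟨ +-monoʳ-≤ n (h-lip (symmetric H e)) ⟩
      n + suc (h v)   ≡⟨ +-suc n (h v) ⟩
      suc (n + h v)   ∎
      where open ≤-Reasoning
    -- Returning gains nothing: the rest of the walk must cross again and already has more than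
    -- `h w` steps.
    from-right {suc n} {v} (edge₂₁ ∷ p) = begin
      h w                 ≤⟨ n≤1+n _ ⟩
      suc (h w)           ≤⟨ m≤n+m _ (g v₁) ⟩
      g v₁ + suc (h w)    ≤⟨ from-left p ⟩
      n                   ≤⟨ m≤m+n n _ ⟩
      n + h v             ≤⟨ n≤1+n _ ⟩
      suc (n + h v)       ∎
      where open ≤-Reasoning

  join-adj? : B.DecidableEquality (Vertex G) → B.DecidableEquality (Vertex H) →
              B.Decidable (Adj G) → B.Decidable (Adj H) → B.Decidable (Adj J)
  join-adj? _≟ᴳ_ _≟ᴴ_ adjᴳ? adjᴴ? = λ where
    (inj₁ u) (inj₁ v) → map′ left (λ { (left e) → e }) (adjᴳ? u v)
    (inj₂ u) (inj₂ v) → map′ right (λ { (right e) → e }) (adjᴴ? u v)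
    (inj₁ u) (inj₂ v) → map′ (λ { (refl , refl) → edge₁₂ }) (λ { edge₁₂ → refl , refl })
                             (u ≟ᴳ v₁ ×-dec v ≟ᴴ v₂)
    (inj₂ v) (inj₁ u) → map′ (λ { (refl , refl) → edge₂₁ }) (λ { edge₂₁ → refl , refl })
                             (u ≟ᴳ v₁ ×-dec v ≟ᴴ v₂)

-- Spines with leaves

data EvenOdd : ℕ → Set where
  even : ∀ k → EvenOdd (k * 2)
  odd  : ∀ k → EvenOdd (1 + k * 2)

evenOdd : ∀ n → EvenOdd n
evenOdd zero          = even 0
evenOdd (suc zero)    = odd 0
evenOdd (suc (suc n)) with evenOdd n
... | even k = even (suc k)
... | odd k  = odd (suc k)

⌊k*2/2⌋≡k : ∀ k → ⌊ k * 2 /2⌋ ≡ k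
⌊k*2/2⌋≡k zero    = refl
⌊k*2/2⌋≡k (suc k) = cong suc (⌊k*2/2⌋≡k k)

⌊1+k*2/2⌋≡k : ∀ k → ⌊ 1 + k * 2 /2⌋ ≡ k
⌊1+k*2/2⌋≡k zero    = refl
⌊1+k*2/2⌋≡k (suc k) = cong suc (⌊1+k*2/2⌋≡k k)

-- The distance to the spine: in both components the even labels are leaves and the odd ones form
-- the spine.
leaf : ℕ → ℕ
leaf zero          = 1
leaf (suc zero)    = 0
leaf (suc (suc n)) = leaf n

leaf-even : ∀ k → leaf (k * 2) ≡ 1
leaf-even zero    = refl
leaf-even (suc k) = leaf-even k

leaf-odd : ∀ k → leaf (1 + k * 2) ≡ 0
leaf-odd zero    = refl
leaf-odd (suc k) = leaf-odd k

-- pos n is the index k of the spine vertex 1 + 2k which carries the label n,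
-- and D measures the distance along the spine to the foot of the leaf v.
module Potential (pos D : ℕ → ℕ) where

  data Step (i j : ℕ) : Set where
    along : leaf i ≡ 0 → leaf j ≡ 0 →
            D (pos i) ≤ suc (D (pos j)) → D (pos j) ≤ suc (D (pos i)) → Step i j
    hang  : leaf i + leaf j ≡ 1 → pos i ≡ pos j → Step i j

  step-sym : B.Symmetric Step
  step-sym (along a b c d)      = along b a d c
  step-sym {i} {j} (hang a b)   = hang (trans (+-comm (leaf j) (leaf i)) a) (sym b)

  -- Models the distance from the leaf `v`: one step to its foot, `D` steps along the spine, one
  -- more if `i` is a leaf. At `v` itself this formula would give 2 instead of 0.
  potential : ℕ → ℕ → ℕ
  potential v i with i ≟ v
  ... | yes _ = 0
  ... | no _  = suc (leaf i + D (pos i))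

  potential-self : ∀ v → potential v v ≡ 0
  potential-self v with v ≟ v
  ... | yes _  = refl
  ... | no v≢v = contradiction refl v≢v

  potential-other : ∀ {v i} → i ≢ v → potential v i ≡ suc (leaf i + D (pos i))
  potential-other {v} {i} i≢v with i ≟ v
  ... | yes i≡v = contradiction i≡v i≢v
  ... | no _    = refl

  module _ {v : ℕ} (v-leaf : leaf v ≡ 1) (D-v : D (pos v) ≡ 0) where

    -- The exceptional value at `v` matters only for neighbours of `v`. No spine edge ends at a
    -- leaf, so such a neighbour is the foot of `v`, where the value is 1.
    potential-step : ∀ {i j} → Step i j → potential v i ≤ suc (potential v j)
    potential-step {i} {j} s with i ≟ v | j ≟ v
    ... | yes _ | _ = z≤n
    potential-step {i} (along _ b _ _) | no _ | yes refl =
      contradiction (trans (sym v-leaf) b) λ ()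
    potential-step {i} (hang a b)      | no _ | yes refl
      rewrite v-leaf | b | D-v | +-identityʳ (leaf i) =
      subst (_≤ 1) (trans (sym a) (+-comm (leaf i) 1)) ≤-refl
    potential-step (along a b c _)     | no _ | no _ rewrite a | b = s≤s c
    potential-step {i} {j} (hang a b)  | no _ | no _ rewrite b =
      s≤s (+-mono-≤ {leaf i} {1} (m+n≤o⇒m≤o (leaf i) (≤-reflexive a)) (m≤n+m _ (leaf j)))

    potential-lipschitz : ∀ {n E} → E ⇒ Step →
                          Lipschitz (fromEdges n E) (λ x → potential v (toℕ x))
    potential-lipschitz E⇒Step (_ , fwd e) = potential-step (E⇒Step e)
    potential-lipschitz E⇒Step (_ , bwd e) = potential-step (step-sym (E⇒Step e))

module Near (n : ℕ) (E : Rel ℕ 0ℓ) where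

  -- Quantifying over all vertices with the given labels lets walks be handled by arithmetic on
  -- labels. The relation is vacuous for labels out of range, so `near-trans` requires the middle
  -- label to be a vertex.
  Near : ℕ → Rel ℕ 0ℓ
  Near d i j = ∀ (u v : Fin n) → toℕ u ≡ i → toℕ v ≡ j → Within (fromEdges n E) d u v

  near-refl : ∀ {d i} → Near d i i
  near-refl u v refl v≡i with Fin.toℕ-injective v≡i
  ... | refl = within-refl

  near-edge : ∀ {i j} → i ≢ j → E i j → Near 1 i j
  near-edge i≢j e u v refl refl = within-adj ((λ { refl → i≢j refl }) , fwd e)

  near-sym : ∀ {d i j} → Near d i j → Near d j i
  near-sym p u v u≡ v≡ = within-sym (p v u v≡ u≡)

  near-mono : ∀ {d e i j} → d ≤ e → Near d i j → Near e i j
  near-mono d≤e p u v u≡ v≡ = within-mono d≤e (p u v u≡ v≡)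

  near-trans : ∀ {d e i j k} → j < n → Near d i j → Near e j k → Near (d + e) i k
  near-trans j<n p q u w u≡ w≡ =
    within-trans (p u (fromℕ< j<n) u≡ (Fin.toℕ-fromℕ< j<n))
                 (q (fromℕ< j<n) w (Fin.toℕ-fromℕ< j<n) w≡)

  module _ {b : ℕ} (spine<n : ∀ {k} → k ≤ b → 1 + k * 2 < n)
           (spine-edge : ∀ {k} → k < b → E (1 + k * 2) (3 + k * 2)) where

    near-path : ∀ t {i} → t + i ≤ b → Near t (1 + i * 2) (1 + (t + i) * 2)
    near-path zero    _        = near-refl
    near-path (suc t) {i} t+i<b =
      subst (λ d → Near d (1 + i * 2) (3 + (t + i) * 2)) (+-comm t 1)
        (near-trans (spine<n (<⇒≤ t+i<b)) (near-path t (<⇒≤ t+i<b))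
          (near-edge (<⇒≢ (s≤s (m<n+m _ {2} (s≤s z≤n)))) (spine-edge t+i<b)))

    near-between : ∀ {i j} → i ≤ j → j ≤ b → Near (j ∸ i) (1 + i * 2) (1 + j * 2)
    near-between {i} {j} i≤j j≤b =
      subst (λ k → Near (j ∸ i) (1 + i * 2) (1 + k * 2)) (m∸n+n≡m i≤j)
        (near-path (j ∸ i) (subst (_≤ b) (sym (m∸n+n≡m i≤j)) j≤b))

adj? : ∀ {n E} → B.Decidable E → B.Decidable (Adj (fromEdges n E))
adj? E? u v = ¬? (u Fin.≟ v) ×-dec
  map′ (λ { (inj₁ e) → fwd e ; (inj₂ e) → bwd e }) (λ { (fwd e) → inj₁ e ; (bwd e) → inj₂ e })
       (E? (toℕ u) (toℕ v) ⊎-dec E? (toℕ v) (toℕ u))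

Spine : ℕ → Rel ℕ 0ℓ
Spine b i j = ∃[ k ] k < b × i ≡ 1 + k * 2 × j ≡ 3 + k * 2

spine? : ∀ b → B.Decidable (Spine b)
spine? b i j = anyUpTo? (λ k → i ≟ 1 + k * 2 ×-dec j ≟ 3 + k * 2) b

1+k*2<2+b*2 : ∀ {k b} → k ≤ b → 1 + k * 2 < 2 + b * 2
1+k*2<2+b*2 k≤b = s≤s (s≤s (*-monoˡ-≤ 2 k≤b))

∣n-k∣≤1+∣1+n-k∣ : ∀ n k → ∣ n - k ∣ ≤ suc ∣ suc n - k ∣
∣n-k∣≤1+∣1+n-k∣ zero    zero    = z≤n
∣n-k∣≤1+∣1+n-k∣ zero    (suc k) = ≤-refl
∣n-k∣≤1+∣1+n-k∣ (suc n) zero    = m≤n⇒m≤1+n (n≤1+n _)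
∣n-k∣≤1+∣1+n-k∣ (suc n) (suc k) = ∣n-k∣≤1+∣1+n-k∣ n k

∣1+n-k∣≤1+∣n-k∣ : ∀ n k → ∣ suc n - k ∣ ≤ suc ∣ n - k ∣
∣1+n-k∣≤1+∣n-k∣ zero    zero    = ≤-refl
∣1+n-k∣≤1+∣n-k∣ zero    (suc k) = m≤n⇒m≤1+n (n≤1+n _)
∣1+n-k∣≤1+∣n-k∣ (suc n) zero    = ≤-refl
∣1+n-k∣≤1+∣n-k∣ (suc n) (suc k) = ∣1+n-k∣≤1+∣n-k∣ n k

-- If `a` is the length of one arc on a cycle of length `N`, the other has length `N ∸ a`. Both
-- lengths change by at most one, hence so does the shorter.
⊓∸-lipschitz : ∀ N {a b} → a ≤ suc b → b ≤ suc a → a ⊓ (N ∸ a) ≤ suc (b ⊓ (N ∸ b))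
⊓∸-lipschitz N {a} {b} a≤1+b b≤1+a = ⊓-mono-≤ a≤1+b (m≤n+o⇒m∸n≤o N a (begin
  N                  ≤⟨ m≤n+m∸n N b ⟩
  b + (N ∸ b)        ≤⟨ +-monoˡ-≤ (N ∸ b) b≤1+a ⟩
  suc a + (N ∸ b)    ≡⟨ +-suc a (N ∸ b) ⟨
  a + suc (N ∸ b)    ∎))
  where open ≤-Reasoning

-- The folded component: a path with leaves

module Folded (m : ℕ) where

  L : ℕ
  L = 3 + m * 2

  Edge : Rel ℕ 0ℓ
  Edge i j = Spine m i j
           ⊎ (∃[ k ] k < suc m × i ≡ 1 + k * 2 × j ≡ 2 + k * 2)
           ⊎ (i ≡ 0 × j ≡ 1)

  edge? : B.Decidable Edge
  edge? i j = spine? m i j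
    ⊎-dec anyUpTo? (λ k → i ≟ 1 + k * 2 ×-dec j ≟ 2 + k * 2) (suc m)
    ⊎-dec (i ≟ 0 ×-dec j ≟ 1)

  private
    half : (m * 2) ℕ./ 2 ≡ m
    half = m*n/n≡m m 2

    1+2k : ∀ k → 2 * k + 1 ≡ 1 + k * 2
    1+2k = solve-∀

    2+2k : ∀ k → 2 * k + 2 ≡ 2 + k * 2
    2+2k = solve-∀

    3+2k : ∀ k → 2 * suc k + 1 ≡ 3 + k * 2
    3+2k = solve-∀

    2k-1 : ∀ k → 2 * suc k ∸ 1 ≡ 1 + k * 2
    2k-1 k = cong pred (*-comm 2 (suc k))

  to-edge : FoldedEdge L ⇒ Edge
  to-edge (odd–odd (suc k) _ k≤ refl refl) = inj₁ (k , subst (suc k ≤_) half k≤ , 2k-1 k , 3+2k k)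
  to-edge (odd–floor k k≤ refl refl) =
    inj₂ (inj₁ (k , s≤s (subst (k ≤_) half k≤) , 1+2k k , 2+2k k))
  to-edge (zero–one i≡0 j≡1) = inj₂ (inj₂ (i≡0 , j≡1))

  from-edge : Edge ⇒ FoldedEdge L
  from-edge (inj₁ (k , k<m , refl , refl)) =
    odd–odd (suc k) (s≤s z≤n) (subst (suc k ≤_) (sym half) k<m) (sym (2k-1 k)) (sym (3+2k k))
  from-edge (inj₂ (inj₁ (k , k<1+m , refl , refl))) =
    odd–floor k (subst (k ≤_) (sym half) (s≤s⁻¹ k<1+m)) (sym (1+2k k)) (sym (2+2k k))
  from-edge (inj₂ (inj₂ (i≡0 , j≡1))) = zero–one i≡0 j≡1

  foldedEdge? : B.Decidable (FoldedEdge L)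
  foldedEdge? i j = map′ from-edge to-edge (edge? i j)

  -- The shift by `pred` reflects that the leaf of `1 + k * 2` is `2 + k * 2`; the truncation at 0
  -- puts vertex 0 at spine vertex 1 as a second leaf.
  pos : ℕ → ℕ
  pos i = ⌊ pred i /2⌋

  open Near L (FoldedEdge L)

  spine<L : ∀ {k} → k ≤ m → 1 + k * 2 < L
  spine<L k≤m = m≤n⇒m≤1+n (1+k*2<2+b*2 k≤m)

  near-spine : ∀ {i j} → i ≤ m → j ≤ m → Near ∣ i - j ∣ (1 + i * 2) (1 + j * 2)
  near-spine {i} {j} i≤m j≤m with ≤-total i j
  ... | inj₁ i≤j rewrite m≤n⇒∣m-n∣≡n∸m i≤j =
        near-between spine<L (λ {k} k<m → from-edge (inj₁ (k , k<m , refl , refl))) i≤j j≤m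
  ... | inj₂ j≤i rewrite m≤n⇒∣n-m∣≡n∸m j≤i = near-sym
        (near-between spine<L (λ {k} k<m → from-edge (inj₁ (k , k<m , refl , refl))) j≤i i≤m)

  foot : ∀ {i} → i < L → pos i ≤ m × Near 1 i (1 + pos i * 2)
  foot {i} i<L with evenOdd i
  ... | even zero = z≤n , near-edge (λ ()) (zero–one refl refl)
  ... | even (suc k) rewrite ⌊1+k*2/2⌋≡k k =
        k≤m , near-sym (near-edge (<⇒≢ (n<1+n _)) (from-edge (inj₂ (inj₁ (k , s≤s k≤m , refl , refl)))))
    where
    k≤m : k ≤ m
    k≤m = *-cancelʳ-≤ k m 2 (s≤s⁻¹ (s≤s⁻¹ (s≤s⁻¹ i<L)))
  ... | odd k rewrite ⌊k*2/2⌋≡k k =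
        ≤-trans (≤-reflexive (sym (⌊k*2/2⌋≡k k)))
          (≤-trans (⌊n/2⌋-mono (s≤s⁻¹ (s≤s⁻¹ i<L))) (≤-reflexive (⌊1+k*2/2⌋≡k m)))
      , near-refl

  within : ∀ u v → Within (folded L) (2 + ∣ pos (toℕ u) - pos (toℕ v) ∣) u v
  within u v with foot (Fin.toℕ<n u) | foot (Fin.toℕ<n v)
  ... | p≤m , near-p | q≤m , near-q =
    within-mono (≤-reflexive (cong suc (+-comm _ 1)))
      (near-trans (spine<L p≤m) near-p
        (near-trans (spine<L q≤m) (near-spine p≤m q≤m) (near-sym near-q)) u v refl refl)

  module _ (k : ℕ) where

    open Potential pos ∣_- k ∣

    step : FoldedEdge L ⇒ Step
    step e with to-edge e
    ... | inj₁ (l , _ , refl , refl) =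
          along (leaf-odd l) (leaf-odd l)
            (∣n-k∣≤1+∣1+n-k∣ ⌊ l * 2 /2⌋ k) (∣1+n-k∣≤1+∣n-k∣ ⌊ l * 2 /2⌋ k)
    ... | inj₂ (inj₁ (l , _ , refl , refl)) =
          hang (cong₂ _+_ (leaf-odd l) (leaf-even l)) (trans (⌊k*2/2⌋≡k l) (sym (⌊1+k*2/2⌋≡k l)))
    ... | inj₂ (inj₂ (refl , refl)) = hang refl refl

    lipschitz : Lipschitz (folded L) (λ x → potential (2 + k * 2) (toℕ x))
    lipschitz = potential-lipschitz (leaf-even k)
      (m≡n⇒∣m-n∣≡0 (⌊1+k*2/2⌋≡k k)) step

    -- The maximum is attained at a leaf of whichever end of the spine is farther from index `k`. In
    -- the second case `k < m`, so the leaf `2 + m * 2` differs from `2 + k * 2`.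
    farthest : ∃[ u ] potential (2 + k * 2) (toℕ {L} u) ≡ 2 + (k ⊔ (m ∸ k))
    farthest with m ∸ k ≤? k
    -- Vertex 0 is taken rather than 2, since for `k = 0` the leaf 2 is the starting point itself.
    ... | yes m∸k≤k = 0F , cong (λ x → 2 + x) (sym (m≥n⇒m⊔n≡m m∸k≤k))
    ... | no m∸k≰k  = fromℕ< 2+2m<L , (begin
        potential (2 + k * 2) (toℕ (fromℕ< 2+2m<L))
          ≡⟨ cong (potential (2 + k * 2)) (Fin.toℕ-fromℕ< 2+2m<L) ⟩
        potential (2 + k * 2) (2 + m * 2)
          ≡⟨ potential-other (<⇒≢ (s≤s (s≤s (*-monoˡ-< 2 k<m))) ∘ sym) ⟩
        1 + (leaf (m * 2) + ∣ ⌊ 1 + m * 2 /2⌋ - k ∣)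
          ≡⟨ cong₂ (λ x y → 1 + (x + ∣ y - k ∣)) (leaf-even m) (⌊1+k*2/2⌋≡k m) ⟩
        2 + ∣ m - k ∣
          ≡⟨ cong (λ x → 2 + x) (m≤n⇒∣n-m∣≡n∸m (<⇒≤ k<m)) ⟩
        2 + (m ∸ k)
          ≡⟨ cong (λ x → 2 + x) (m≤n⇒m⊔n≡n (<⇒≤ (≰⇒> m∸k≰k))) ⟨
        2 + (k ⊔ (m ∸ k))  ∎)
      where
      open ≡-Reasoning
      k<m : k < m
      k<m = <-≤-trans (≰⇒> m∸k≰k) (m∸n≤m m k)
      2+2m<L : 2 + m * 2 < L
      2+2m<L = n<1+n _

    within-leaf : ∀ {v} → toℕ v ≡ 2 + k * 2 → ∀ u → Within (folded L) (2 + (k ⊔ (m ∸ k))) u v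
    within-leaf {v} v≡ u = within-mono (s≤s (s≤s bound)) (within u v)
      where
      bound : ∣ pos (toℕ u) - pos (toℕ v) ∣ ≤ k ⊔ (m ∸ k)
      bound rewrite v≡ | ⌊1+k*2/2⌋≡k k with ≤-total (pos (toℕ u)) k
      ... | inj₁ p≤k rewrite m≤n⇒∣m-n∣≡n∸m p≤k =
            ≤-trans (m∸n≤m k (pos (toℕ u))) (m≤m⊔n k (m ∸ k))
      ... | inj₂ k≤p rewrite m≤n⇒∣n-m∣≡n∸m k≤p =
            ≤-trans (∸-monoˡ-≤ k (proj₁ (foot (Fin.toℕ<n u)))) (m≤n⊔m k (m ∸ k))

  within-all : ∀ u v → Within (folded L) (2 + m) u v
  within-all u v = within-mono (s≤s (s≤s
    (≤-trans (∣m-n∣≤m⊔n (pos (toℕ u)) (pos (toℕ v)))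
             (⊔-lub (proj₁ (foot (Fin.toℕ<n u))) (proj₁ (foot (Fin.toℕ<n v))))))) (within u v)

-- The stacked component: an odd cycle with leaves

module Stacked (m : ℕ) where

  L : ℕ
  L = 3 + m * 2

  -- The last spine index is `2 + m * 2`, one less than `L`; the third case closes the spine path to
  -- a cycle.
  Edge : Rel ℕ 0ℓ
  Edge i j = Spine (2 + m * 2) i j
           ⊎ (∃[ k ] k < L × i ≡ k * 2 × j ≡ 1 + k * 2)
           ⊎ (i ≡ 1 + (2 + m * 2) * 2 × j ≡ 1)

  edge? : B.Decidable Edge
  edge? i j = spine? (2 + m * 2) i j
    ⊎-dec anyUpTo? (λ k → i ≟ k * 2 ×-dec j ≟ 1 + k * 2) L
    ⊎-dec (i ≟ 1 + (2 + m * 2) * 2 ×-dec j ≟ 1)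

  private
    1+2k : ∀ k → 2 * k + 1 ≡ 1 + k * 2
    1+2k = solve-∀

    3+2k : ∀ k → 2 * k + 3 ≡ 3 + k * 2
    3+2k = solve-∀

    last : 2 * L ∸ 1 ≡ 1 + (2 + m * 2) * 2
    last = cong pred (*-comm 2 L)

  to-edge : StackedEdge L ⇒ Edge
  to-edge (odd–odd k k≤ refl refl)   = inj₁ (k , s≤s k≤ , 1+2k k , 3+2k k)
  to-edge (floor–odd k k≤ refl refl) = inj₂ (inj₁ (k , s≤s k≤ , *-comm 2 k , 1+2k k))
  to-edge (closing refl refl)        = inj₂ (inj₂ (last , refl))

  from-edge : Edge ⇒ StackedEdge L
  from-edge (inj₁ (k , k< , refl , refl)) =
    odd–odd k (s≤s⁻¹ k<) (sym (1+2k k)) (sym (3+2k k))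
  from-edge (inj₂ (inj₁ (k , k< , refl , refl))) =
    floor–odd k (s≤s⁻¹ k<) (*-comm k 2) (sym (1+2k k))
  from-edge (inj₂ (inj₂ (refl , refl))) = closing (sym last) refl

  stackedEdge? : B.Decidable (StackedEdge L)
  stackedEdge? i j = map′ from-edge to-edge (edge? i j)

  open Near (2 * L) (StackedEdge L)

  spine<2L : ∀ {k} → k ≤ 2 + m * 2 → 1 + k * 2 < 2 * L
  spine<2L {k} k≤ = subst (1 + k * 2 <_) (*-comm L 2) (1+k*2<2+b*2 k≤)

  near-spine : ∀ {i j} → i ≤ j → j ≤ 2 + m * 2 → Near (j ∸ i) (1 + i * 2) (1 + j * 2)
  near-spine = near-between spine<2L (λ {k} k< → from-edge (inj₁ (k , k< , refl , refl)))

  -- On a cycle of odd length `3 + m * 2` one of the two arcs has length at most `1 + m`. If the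
  -- direct arc is too long, the walk goes down to index 0, over the closing edge, and back from the
  -- last index to `j`.
  near-cycle : ∀ {i j} → i ≤ j → j ≤ 2 + m * 2 → Near (1 + m) (1 + i * 2) (1 + j * 2)
  near-cycle {i} {j} i≤j j≤ with j ∸ i ≤? 1 + m
  ... | yes short = near-mono short (near-spine i≤j j≤)
  ... | no long = near-mono bound
    (near-trans {j = 1} (spine<2L z≤n) (near-sym (near-spine z≤n (≤-trans i≤j j≤)))
      (near-trans (spine<2L ≤-refl)
        (near-sym (near-edge (λ ()) (from-edge (inj₂ (inj₂ (refl , refl))))))
        (near-sym (near-spine j≤ ≤-refl))))
    where
    r = 2 + m * 2 ∸ j

    regroup : ∀ i t r → 1 + t + (i + (1 + r)) ≡ 2 + (r + (t + i))
    regroup = solve-∀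

    double : ∀ m → 2 + (2 + m * 2) ≡ 2 + m + (1 + m) + 1
    double = solve-∀

    bound : i + (1 + r) ≤ 1 + m
    -- The two arcs add up to `3 + m * 2`, and the direct one has length at least `2 + m`.
    bound = +-cancelˡ-≤ (3 + m) _ _ (begin
      3 + m + (i + (1 + r))        ≤⟨ +-monoˡ-≤ (i + (1 + r)) (s≤s (≰⇒> long)) ⟩
      1 + (j ∸ i) + (i + (1 + r))  ≡⟨ regroup i (j ∸ i) r ⟩
      2 + (r + (j ∸ i + i))        ≡⟨ cong (λ k → 2 + (r + k)) (m∸n+n≡m i≤j) ⟩
      2 + (r + j)                  ≡⟨ cong (λ k → 2 + k) (m∸n+n≡m j≤) ⟩
      2 + (2 + m * 2)              ≡⟨ double m ⟩
      2 + m + (1 + m) + 1          ≡⟨ +-comm _ 1 ⟩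
      3 + m + (1 + m)              ∎)
      where open ≤-Reasoning

  foot : ∀ {i} → i < 2 * L → ⌊ i /2⌋ ≤ 2 + m * 2 × Near 1 i (1 + ⌊ i /2⌋ * 2)
  foot {i} i<2L = p≤ , near
    where
    p≤ : ⌊ i /2⌋ ≤ 2 + m * 2
    p≤ = ≤-trans (⌊n/2⌋-mono (s≤s⁻¹ (subst (i <_) (*-comm 2 L) i<2L)))
                 (≤-reflexive (⌊1+k*2/2⌋≡k (2 + m * 2)))
    near : Near 1 i (1 + ⌊ i /2⌋ * 2)
    near with evenOdd i
    ... | odd k rewrite ⌊1+k*2/2⌋≡k k = near-refl
    ... | even k with p≤
    ...   | k≤ rewrite ⌊k*2/2⌋≡k k =
            near-edge (<⇒≢ (n<1+n _)) (from-edge (inj₂ (inj₁ (k , s≤s k≤ , refl , refl))))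

  within : ∀ u v → Within (stacked L) (3 + m) u v
  within u v with foot (Fin.toℕ<n u) | foot (Fin.toℕ<n v)
  ... | p≤ , near-p | q≤ , near-q =
    within-mono (≤-reflexive (cong suc (+-comm _ 1)))
      (near-trans (spine<2L p≤) near-p
        (near-trans (spine<2L q≤) middle (near-sym near-q)) u v refl refl)
    where
    middle : Near (1 + m) (1 + ⌊ toℕ u /2⌋ * 2) (1 + ⌊ toℕ v /2⌋ * 2)
    middle with ≤-total ⌊ toℕ u /2⌋ ⌊ toℕ v /2⌋
    ... | inj₁ p≤q = near-cycle p≤q q≤
    ... | inj₂ q≤p = near-sym (near-cycle q≤p p≤)

  module _ {c : ℕ} (c≤ : c ≤ 2 + m * 2) where

    -- The distance from spine index `c` on the cycle, as the shorter of the two arcs.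
    cyclic : ℕ → ℕ
    cyclic p = ∣ p - c ∣ ⊓ (L ∸ ∣ p - c ∣)

    open Potential ⌊_/2⌋ cyclic

    private r = 2 + m * 2 ∸ c

    -- Along the closing edge `∣_- c ∣` itself may jump. The arcs have lengths `c` and `suc r` at
    -- index 0, but `suc c` and `r` at the last index, so the shorter one still changes by at most
    -- one.
    cyclic-0 : cyclic 0 ≡ c ⊓ suc r
    cyclic-0 = cong (c ⊓_) (+-∸-assoc 1 c≤)

    cyclic-last : cyclic (2 + m * 2) ≡ r ⊓ suc c
    cyclic-last rewrite m≤n⇒∣n-m∣≡n∸m c≤ =
      cong (r ⊓_) (trans (+-∸-assoc 1 (m∸n≤m (2 + m * 2) c)) (cong suc (m∸[m∸n]≡n c≤)))

    step : StackedEdge L ⇒ Step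
    step e with to-edge e
    ... | inj₁ (l , _ , refl , refl) = along (leaf-odd l) (leaf-odd l)
          (⊓∸-lipschitz L near far) (⊓∸-lipschitz L far near)
      where
      near = ∣n-k∣≤1+∣1+n-k∣ ⌊ 1 + l * 2 /2⌋ c
      far  = ∣1+n-k∣≤1+∣n-k∣ ⌊ 1 + l * 2 /2⌋ c
    ... | inj₂ (inj₁ (l , _ , refl , refl)) =
          hang (cong₂ _+_ (leaf-even l) (leaf-odd l)) (trans (⌊k*2/2⌋≡k l) (sym (⌊1+k*2/2⌋≡k l)))
    ... | inj₂ (inj₂ (refl , refl)) = along (leaf-odd (2 + m * 2)) refl
          (subst₂ _≤_ (sym at-last) (cong suc (sym cyclic-0)) (flip-⊓ r c))
          (subst₂ _≤_ (sym cyclic-0) (cong suc (sym at-last)) (flip-⊓ c r))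
      where
      at-last : cyclic ⌊ 1 + (2 + m * 2) * 2 /2⌋ ≡ r ⊓ suc c
      at-last = trans (cong cyclic (⌊1+k*2/2⌋≡k (2 + m * 2))) cyclic-last

      flip-⊓ : ∀ a b → a ⊓ suc b ≤ suc (b ⊓ suc a)
      flip-⊓ a b = ⊓-glb (m⊓n≤n a (suc b)) (≤-trans (m⊓n≤m a (suc b)) (m≤n⇒m≤1+n (n≤1+n a)))

    lipschitz : Lipschitz (stacked L) (λ x → potential (c * 2) (toℕ x))
    lipschitz = potential-lipschitz (leaf-even c)
      (cong (λ d → d ⊓ (L ∸ d)) (m≡n⇒∣m-n∣≡0 (⌊k*2/2⌋≡k c))) step

    -- Going `1 + m` indices forward from `c` stays on the spine when `c ≤ 1 + m`; otherwise there
    -- is room to go backward.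
    antipode : ∃[ p ] p ≤ 2 + m * 2 × ∣ p - c ∣ ≡ 1 + m
    antipode with c ≤? 1 + m
    ... | yes c≤1+m = c + (1 + m)
        , ≤-trans (+-monoˡ-≤ (1 + m) c≤1+m) (≤-reflexive (double m))
        , trans (∣-∣-comm (c + (1 + m)) c) (∣m-m+n∣≡n c (1 + m))
      where
      double : ∀ m → 1 + m + (1 + m) ≡ 2 + m * 2
      double = solve-∀
    ... | no c≰1+m = c ∸ (1 + m)
        , ≤-trans (m∸n≤m c (1 + m)) c≤
        , trans (m≤n⇒∣m-n∣≡n∸m (m∸n≤m c (1 + m))) (m∸[m∸n]≡n (<⇒≤ (≰⇒> c≰1+m)))

    farthest : ∃[ w ] potential (c * 2) (toℕ {2 * L} w) ≡ 3 + m
    farthest with antipode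
    ... | p , p≤ , ∣p-c∣≡ = fromℕ< 2p<2L , (begin
        potential (c * 2) (toℕ (fromℕ< 2p<2L))
          ≡⟨ cong (potential (c * 2)) (Fin.toℕ-fromℕ< 2p<2L) ⟩
        potential (c * 2) (p * 2)
          ≡⟨ potential-other (p≢c ∘ *-cancelʳ-≡ p c 2) ⟩
        1 + (leaf (p * 2) + cyclic ⌊ p * 2 /2⌋)
          ≡⟨ cong₂ (λ x y → 1 + (x + cyclic y)) (leaf-even p) (⌊k*2/2⌋≡k p) ⟩
        2 + cyclic p
          ≡⟨ cong (λ d → 2 + (d ⊓ (L ∸ d))) ∣p-c∣≡ ⟩
        2 + ((1 + m) ⊓ (L ∸ (1 + m)))
          ≡⟨ cong (λ x → 2 + x) (m≤n⇒m⊓n≡m half) ⟩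
        3 + m  ∎)
      where
      open ≡-Reasoning
      2p<2L : p * 2 < 2 * L
      2p<2L = <-trans (n<1+n _) (spine<2L p≤)

      p≢c : p ≢ c
      p≢c p≡c = 0≢1+n (trans (sym (m≡n⇒∣m-n∣≡0 p≡c)) ∣p-c∣≡)

      1+double : ∀ m → 1 + (1 + m + (1 + m)) ≡ 3 + m * 2
      1+double = solve-∀

      half : 1 + m ≤ L ∸ (1 + m)
      half = m+n≤o⇒m≤o∸n (1 + m) (≤-trans (n≤1+n _) (≤-reflexive (1+double m)))

-- The diameter of the join and its bounds

join-diameter : ∀ m k {c} → c ≤ 2 + m * 2 →
  (v₁ : Vertex (folded (3 + m * 2))) → toℕ v₁ ≡ 2 + k * 2 →
  (v₂ : Vertex (stacked (3 + m * 2))) → toℕ v₂ ≡ c * 2 →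
  IsDiameter (join (folded (3 + m * 2)) (stacked (3 + m * 2)) v₁ v₂)
             (2 + (k ⊔ (m ∸ k)) + suc (3 + m))
join-diameter m k {c} c≤ v₁ v₁≡ v₂ v₂≡ =
  isDiameter (Sum.≡-dec Fin._≟_ Fin._≟_) (⊎-searchable Fin.any? Fin.any?)
    (join-adj? Fin._≟_ Fin._≟_ (adj? F.foldedEdge?) (adj? T.stackedEdge?))
    (join-within (F.within-leaf k v₁≡) (λ v → T.within v v₂)
       -- The common diameter bound is `3 + m`, the larger of the bounds for the two components.
       (λ u u′ → within-mono (n≤1+n (2 + m)) (F.within-all u u′)) T.within
       (≤-trans (n≤1+n (3 + m)) (m≤n+m _ (2 + (k ⊔ (m ∸ k))))))
    (inj₁ u) (inj₂ w)
    (λ n p → subst₂ (λ x y → x + suc y ≤ n) u-far w-far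
      (join-far (F.lipschitz k) (trans (cong (FP.potential (2 + k * 2)) v₁≡) (FP.potential-self (2 + k * 2)))
                (T.lipschitz c≤) (trans (cong (TP.potential (c * 2)) v₂≡) (TP.potential-self (c * 2)))
                u w n p))
  where
  module F = Folded m
  module T = Stacked m
  module FP = Potential F.pos ∣_- k ∣
  module TP = Potential ⌊_/2⌋ (T.cyclic c≤)

  u = proj₁ (F.farthest k)
  u-far = proj₂ (F.farthest k)
  w = proj₁ (T.farthest c≤)
  w-far = proj₂ (T.farthest c≤)

¾*m≤n : ∀ m n → 3 * m ≤ n * 4 → (+ 3 / 4) ℚ.* (+ m / 1) ℚ.≤ (+ n / 1)
¾*m≤n m n 3m≤4n = ℚ.*≤* (subst₂ ℤ._≤_
  (trans (ℤ.pos-* 3 m) (sym (ℤ.*-identityʳ _))) (ℤ.pos-* n 4) (ℤ.+≤+ 3m≤4n))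

-- The larger part of a path cut at index `k` is at least half of it; this is the source of the
-- factor 3/4.
m≤2[k⊔m∸k] : ∀ m k → m ≤ 2 * (k ⊔ (m ∸ k))
m≤2[k⊔m∸k] m k = begin
  m                                ≤⟨ m≤n+m∸n m k ⟩
  k + (m ∸ k)                      ≤⟨ +-mono-≤ (m≤m⊔n k (m ∸ k)) (m≤n⊔m k (m ∸ k)) ⟩
  (k ⊔ (m ∸ k)) + (k ⊔ (m ∸ k))    ≡⟨ cong ((k ⊔ (m ∸ k)) ℕ.+_) (+-identityʳ _) ⟨
  2 * (k ⊔ (m ∸ k))                ∎
  where open ≤-Reasoning

theorem41 : ∀ (p : ℕ) → Prime p → p % 120 ≡ 71 ⊎ p % 120 ≡ 119 →
    ∀ (L : ℕ) → IsOrd₂ p L → ¬ (2 ∣ L) → 3 ≤ L →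
    ∀ (v₁ : Vertex (folded L)) → IsFoldedFloor {L} v₁ →
    ∀ (v₂ : Vertex (stacked L)) → IsStackedFloor {L} v₂ →
    ∃[ d ] IsDiameter (join (folded L) (stacked L) v₁ v₂) d
    × (+ 3 / 4) ℚ.* (+ (L + 5) / 1) ℚ.≤ (+ d / 1)
    × d ≤ L + 3
theorem41 _ _ _ L _ 2∤L 3≤L v₁ (divides q v₁≡ , v₁≢0) v₂ (divides c v₂≡) with evenOdd L | q
... | even l      | _     = contradiction (divides l refl) 2∤L
... | odd zero    | _     = contradiction 3≤L λ { (s≤s ()) }
... | odd (suc m) | zero  = contradiction v₁≡ v₁≢0
-- Here `v₁` has label `2 + k * 2`, so it is the leaf of spine index `k`.
... | odd (suc m) | suc k = 2 + e + suc (3 + m)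
    , join-diameter m k c≤ v₁ v₁≡ v₂ v₂≡
    , ¾*m≤n (3 + m * 2 + 5) (2 + e + suc (3 + m)) lower
    , upper
  where
  open ≤-Reasoning

  e = k ⊔ (m ∸ k)

  c≤ : c ≤ 2 + m * 2
  c≤ = s≤s⁻¹ (*-cancelʳ-< 2 c (3 + m * 2)
    (subst₂ _<_ v₂≡ (*-comm 2 (3 + m * 2)) (Fin.toℕ<n v₂)))

  k≤m : k ≤ m
  k≤m = *-cancelʳ-≤ k m 2 (s≤s⁻¹ (s≤s⁻¹ (s≤s⁻¹ (subst (_< 3 + m * 2) v₁≡ (Fin.toℕ<n v₁)))))

  split : ∀ m → 3 * (3 + m * 2 + 5) ≡ m * 2 + (24 + m * 4)
  split = solve-∀

  collect : ∀ m e → 2 * e * 2 + (24 + m * 4) ≡ (2 + e + (1 + (3 + m))) * 4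
  collect = solve-∀

  total : ∀ m → 2 + m + (1 + (3 + m)) ≡ 3 + m * 2 + 3
  total = solve-∀

  lower : 3 * (3 + m * 2 + 5) ≤ (2 + e + suc (3 + m)) * 4
  lower = begin
    3 * (3 + m * 2 + 5)          ≡⟨ split m ⟩
    -- Of the six copies of `m`, two are traded for four copies of `e`, which makes the total
    -- divisible by 4.
    m * 2 + (24 + m * 4)         ≤⟨ +-monoˡ-≤ _ (*-monoˡ-≤ 2 (m≤2[k⊔m∸k] m k)) ⟩
    2 * e * 2 + (24 + m * 4)     ≡⟨ collect m e ⟩
    (2 + e + suc (3 + m)) * 4    ∎

  upper : 2 + e + suc (3 + m) ≤ 3 + m * 2 + 3
  upper = begin
    2 + e + suc (3 + m)    ≤⟨ +-monoˡ-≤ (suc (3 + m)) (s≤s (s≤s (⊔-lub k≤m (m∸n≤m m k)))) ⟩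
    2 + m + suc (3 + m)    ≡⟨ total m ⟩
    3 + m * 2 + 3          ∎
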